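{- If $f:\{0,1\}^n\to\{ -1,1\}$ is $\varepsilon$-far from linear, where $\varepsilon\in(0,1/2]$, and $k\ge2$ is even, then $$\Pr\left[\text{XorTest}_k(f)\text{ rejects}\right]\ \ge\ \frac{1-(1-2\varepsilon)^{k-1}}{2}\ \ge\ \min\left\{\frac14,\frac{k\varepsilon}{2}\right\}.$$
   Context: A function $f:\{0,1\}^n\to\{ -1,1\}$ is linear if $f(x)\cdot f(y)=f(x\oplus y)$ for all $x,y\in\{0,1\}^n$ ($\oplus$ is bitwise XOR; this is the $\pm1$ encoding of Boolean values). $f$ is $\varepsilon$-far from linear if it differs from every linear function on at least an $\varepsilon$ fraction of the domain. $\text{XorTest}_k$ chooses $x_1,\dots,x_k\in\{0,1\}^n$ independently and uniformly at random (with replacement), sets $y=\bigoplus_{i\in[k]}x_i$, and accepts if $f(y)=\prod_{i\in[k]}f(x_i)$; otherwise it rejects. -}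

module Defs where

open import Algebra.Apartness.Bundles using (HeytingField)
open import Algebra.Apartness.Structures using (IsHeytingField)
open import Algebra.Bundles using (CommutativeRing; Semiring)
open import Algebra.Core using (Op₁; Op₂)
import Algebra.Definitions
import Algebra.Definitions.RawSemiring
import Algebra.Properties.Ring as RingProperties
open import Data.Bool.Base using (Bool; true; false; _xor_)
open import Data.Empty using (⊥-elim)
open import Data.List.Base using (List; []; _∷_; length; filter; cartesianProductWith)
open import Data.Nat.Base using (ℕ; zero; suc; NonZero)
open import Data.Product.Base using (_,_; proj₁; proj₂)
open import Data.Sign.Base as S using (Sign)
open import Data.Sign.Properties using () renaming (_≟_ to _≟ₛ_)
open import Data.Sum.Base using (_⊎_; inj₁; inj₂)
open import Data.Vec.Base as Vec using (Vec; []; _∷_)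
open import Level as L using (Level; _⊔_)
open import Relation.Binary.Core using (Rel)
open import Relation.Binary.Lattice.Definitions using (Infimum)
open import Relation.Binary.PropositionalEquality.Core using (_≡_; _≢_)
open import Relation.Binary.Structures using (IsStrictPartialOrder)
open import Relation.Nullary.Decidable.Core using (¬?)
open import Relation.Nullary.Negation.Core using (¬_)
open import Relation.Unary using (Pred; Decidable)

private
  variable
    a p : Level
    A : Set a

-- In the absence of real numbers, real quantities are taken in an arbitrary
-- ordered field.  The axioms are those of constructive ordered fields: they hold
-- for the classical reals, for the constructive (Cauchy or Dedekind) reals, where
-- the order is not decidable, and for ℚ.
-- Both x ≤ y as ¬ (y < x) and x # y as (x < y or y < x) are the usual constructive
-- readings; cotransitivity and tightness of # make < weakly linear and ≤
-- antisymmetric, and 0# < 1# is derivable (see 0<1).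

record OrderedField c ℓ₁ ℓ₂ ℓ₃ : Set (L.suc (c ⊔ ℓ₁ ⊔ ℓ₂ ⊔ ℓ₃)) where
  infix  8 -_
  infixl 7 _*_ _/_ _⊓_
  infixl 6 _+_
  infix  4 _≈_ _#_ _<_ _≤_ _≥_

  field
    Carrier        : Set c
    _≈_            : Rel Carrier ℓ₁
    _#_            : Rel Carrier ℓ₂
    _<_            : Rel Carrier ℓ₃
    _+_ _*_ _⊓_    : Op₂ Carrier
    -_             : Op₁ Carrier
    0# 1#          : Carrier
    isHeytingField : IsHeytingField _≈_ _#_ _+_ _*_ -_ 0# 1#

  _≤_ : Rel Carrier ℓ₃
  _≤_ = λ x y → ¬ (y < x)

  field
    <-isStrictPartialOrder : IsStrictPartialOrder _≈_ _<_
    #⇒<⊎>                  : ∀ {x y} → x # y → x < y ⊎ y < x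
    <⇒#                    : ∀ {x y} → x < y → x # y
    +-monoʳ-<              : ∀ x {y z} → y < z → x + y < x + z
    *-pos                  : ∀ {x y} → 0# < x → 0# < y → 0# < x * y
    ⊓-infimum              : Infimum _≤_ _⊓_

  _≥_ : Rel Carrier ℓ₃
  x ≥ y = y ≤ x

  open IsHeytingField isHeytingField public
  module <-Order = IsStrictPartialOrder <-isStrictPartialOrder

  heytingField : HeytingField c ℓ₁ ℓ₂
  heytingField = record { isHeytingField = isHeytingField }

  commutativeRing : CommutativeRing c ℓ₁
  commutativeRing = record { isCommutativeRing = isCommutativeRing }

  open CommutativeRing commutativeRing public using (ring; semiring)
  open Algebra.Definitions.RawSemiring (Semiring.rawSemiring semiring) public
    using (_^_) renaming (_×_ to infixr 8 _·_)
  open Algebra.Definitions _≈_ public using (Invertible)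

  private
    open RingProperties ring using (-0#≈0#; -‿involutive; -‿distribˡ-*)

    x-0≈x : ∀ x → x - 0# ≈ x
    x-0≈x x = trans (+-congˡ -0#≈0#) (+-identityʳ x)

    <-respʳ : ∀ {x y z} → y ≈ z → x < y → x < z
    <-respʳ = proj₁ <-Order.<-resp-≈

    <-respˡ : ∀ {x y z} → y ≈ z → y < x → z < x
    <-respˡ = proj₂ <-Order.<-resp-≈

  0<1 : 0# < 1#
  0<1 with #⇒<⊎> (invertible⇒# {1#} {0#} (1# , 1*[1-0] , [1-0]*1))
    where
    1*[1-0] : 1# * (1# - 0#) ≈ 1#
    1*[1-0] = trans (*-identityˡ _) (x-0≈x 1#)
    [1-0]*1 : (1# - 0#) * 1# ≈ 1#
    [1-0]*1 = trans (*-identityʳ _) (x-0≈x 1#)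
  ... | inj₂ 0<1′ = 0<1′
  ... | inj₁ 1<0 = <-respʳ -1*-1≈1 (*-pos 0<-1 0<-1)
    where
    0<-1 : 0# < - 1#
    0<-1 = <-respˡ (-‿inverseˡ 1#) (<-respʳ (+-identityʳ (- 1#)) (+-monoʳ-< (- 1#) 1<0))
    -1*-1≈1 : - 1# * - 1# ≈ 1#
    -1*-1≈1 = trans (sym (-‿distribˡ-* 1# (- 1#)))
                    (trans (-‿cong (*-identityˡ (- 1#))) (-‿involutive 1#))

  0<suc : ∀ n → 0# < suc n · 1#
  0<suc zero    = <-respʳ (sym (+-identityʳ 1#)) 0<1
  0<suc (suc n) = <-Order.trans 0<1
    (<-respˡ (+-identityʳ 1#) (+-monoʳ-< 1# (0<suc n)))

  ℕ-invertible : ∀ n .{{_ : NonZero n}} → Invertible 1# _*_ (n · 1#)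
  ℕ-invertible (suc n) with #⇒invertible (#-sym (<⇒# (0<suc n)))
  ... | y , invˡ , invʳ =
    y , trans (*-congˡ (sym (x-0≈x _))) invˡ , trans (*-congʳ (sym (x-0≈x _))) invʳ

  _/_ : Carrier → ∀ n .{{_ : NonZero n}} → Carrier
  x / n = x * proj₁ (ℕ-invertible n)

Cube : ℕ → Set
Cube n = Vec Bool n

infixl 6 _⊕_

_⊕_ : ∀ {n} → Cube n → Cube n → Cube n
_⊕_ = Vec.zipWith _xor_

⨁ : ∀ {n k} → Vec (Cube n) k → Cube n
⨁ {n} = Vec.foldr′ _⊕_ (Vec.replicate n false)

∏ : ∀ {k} → Vec Sign k → Sign
∏ = Vec.foldr′ S._*_ S.+

Linear : ∀ {n} → (Cube n → Sign) → Set
Linear f = ∀ x y → f x S.* f y ≡ f (x ⊕ y)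

-- The vector xs holds the random choices of the test.
XorTestAccepts XorTestRejects : ∀ {n k} → (Cube n → Sign) → Pred (Vec (Cube n) k) _
XorTestAccepts f xs = f (⨁ xs) ≡ ∏ (Vec.map f xs)
XorTestRejects f xs = ¬ XorTestAccepts f xs

xorTestRejects? : ∀ {n k} (f : Cube n → Sign) → Decidable (XorTestRejects {n} {k} f)
xorTestRejects? f xs = ¬? (f (⨁ xs) ≟ₛ ∏ (Vec.map f xs))

-- Each tuple of entries of xs, once; listing all of A lists all of Vec A n.
tuples : List A → ∀ n → List (Vec A n)
tuples xs zero    = [] ∷ []
tuples xs (suc n) = cartesianProductWith _∷_ xs (tuples xs n)

cube : ∀ n → List (Cube n)
cube = tuples (false ∷ true ∷ [])

tuples-nonZero : ∀ (xs : List A) .{{_ : NonZero (length xs)}} n →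
                 NonZero (length (tuples xs n))
tuples-nonZero xs       zero    = _
tuples-nonZero (x ∷ xs) (suc n)
  with tuples (x ∷ xs) n | tuples-nonZero (x ∷ xs) n
... | _ ∷ _ | _ = _

cube-nonZero : ∀ n → NonZero (length (cube n))
cube-nonZero = tuples-nonZero (false ∷ true ∷ [])

module Testing {c ℓ₁ ℓ₂ ℓ₃} (K : OrderedField c ℓ₁ ℓ₂ ℓ₃) where
  open OrderedField K

  -- The probability of P under the uniform distribution on the entries of Ω.
  Pr : {P : Pred A p} → Decidable P → (Ω : List A) .{{_ : NonZero (length Ω)}} → Carrier
  Pr P? Ω = (length (filter P? Ω) · 1#) / length Ω

  distance : ∀ {n} → (f g : Cube n → Sign) → Carrier
  distance {n} f g = Pr (λ x → ¬? (f x ≟ₛ g x)) (cube n)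
    where instance _ = cube-nonZero n

  FarFromLinear : ∀ {n} → Carrier → (Cube n → Sign) → Set _
  FarFromLinear ε f = ∀ g → Linear g → distance f g ≥ ε

  -- Independent uniform x₁, …, x_k amount to a uniform k-tuple.
  Pr[XorTest_rejects_] : ∀ {n} → ℕ → (Cube n → Sign) → Carrier
  Pr[XorTest_rejects_] {n} k f = Pr (xorTestRejects? f) (tuples (cube n) k)
    where instance
      _ = cube-nonZero n
      _ = tuples-nonZero (cube n) k

{-# OPTIONS --safe #-}
module Submission where

-- Write N = 2 ^ n, F(S) = ∑ₓ f(x) χ_S(x) and A = 1 - 2ε.  Fourier inversion turns
-- ∑_S F(S) ^ (k + 1) into N ∑ f(⨁ xs) ∏ f(xᵢ), the sum being over all k-tuples, and
-- that sum is N ^ k minus twice the number of rejected tuples.  Farness from each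
-- character gives F(S) ≤ A N.  As k - 1 is odd, F(S) ^ (k - 1) ≤ (A N) ^ (k - 1) even
-- if F(S) < 0, and Parseval's ∑_S F(S)² = N² bounds the sum by A ^ (k - 1) N ^ k.

open import Algebra.Bundles using (CommutativeRing)
import Algebra.Properties.CommutativeSemigroup as CommutativeSemigroupProperties
import Algebra.Properties.CommutativeSemiring.Exp as ExpProperties
import Algebra.Properties.Ring as RingProperties
import Algebra.Properties.Semiring.Mult as MultProperties
import Algebra.Solver.Ring.NaturalCoefficients.Default as SemiringSolver
open import Data.Bool.Base using (Bool; true; false; _∧_; _xor_)
open import Data.Bool.Properties using (xor-identityʳ)
open import Data.List.Base using (List; []; _∷_; _++_; length; map; filter; cartesianProductWith)
open import Data.Nat.Base as ℕ using (ℕ; zero; suc; NonZero; _∸_) renaming (_≤_ to _≤ℕ_)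
open import Data.Nat.Divisibility using (_∣_; divides)
open import Data.Product.Base using (_×_; _,_; proj₁; proj₂)
open import Data.Sign.Base as S using (Sign)
import Data.Sign.Properties as S
open import Data.Sum.Base using (_⊎_; inj₁; inj₂; [_,_]′)
open import Data.Vec.Base as Vec using (Vec; []; _∷_)
open import Data.Vec.Properties using (zipWith-identityʳ)
open import Function.Base using (_∘_)
open import Level using (Level)
open import Relation.Binary.PropositionalEquality as ≡ using (_≡_)
import Relation.Binary.Reasoning.Base.Triple as Triple
open import Relation.Binary.Structures using (IsPreorder)
open import Relation.Nullary.Decidable.Core using (yes; no; ¬?)
open import Relation.Nullary.Negation.Core using (¬_; contradiction)
open import Defs

private
  variable
    a b : Level
    A : Set a
    B : Set b

-- Order and arithmetic in a constructive ordered field.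

module OrderedFieldProperties {c ℓ₁ ℓ₂ ℓ₃} (K : OrderedField c ℓ₁ ℓ₂ ℓ₃) where
  open OrderedField K hiding (zero)
  open CommutativeRing commutativeRing public
    using (commutativeSemiring; +-commutativeSemigroup; *-commutativeSemigroup)
  open RingProperties ring public
  open MultProperties semiring public
    using (×-comm-*; ×-assoc-*)
    renaming (×-congʳ to ·-congˡ)
  open ExpProperties commutativeSemiring public
    using (^-distrib-*)
  open SemiringSolver commutativeSemiring public
    using (solve; _:+_; _:*_; _:=_; con)

  <-cotrans : ∀ {x y} → x < y → ∀ z → (x < z) ⊎ (z < y)
  <-cotrans {x} {y} x<y z with #-cotrans (<⇒# x<y) z
  ... | inj₁ x#z with #⇒<⊎> x#z
  ...   | inj₁ x<z = inj₁ x<z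
  ...   | inj₂ z<x = inj₂ (<-Order.trans z<x x<y)
  <-cotrans {x} {y} x<y z | inj₂ z#y with #⇒<⊎> z#y
  ...   | inj₁ z<y = inj₂ z<y
  ...   | inj₂ y<z = inj₁ (<-Order.trans x<y y<z)

  <⇒≤ : ∀ {x y} → x < y → x ≤ y
  <⇒≤ = <-Order.asym

  ≤-reflexive : ∀ {x y} → x ≈ y → x ≤ y
  ≤-reflexive x≈y y<x = <-Order.irrefl (sym x≈y) y<x

  <-≤-trans : ∀ {x y z} → x < y → y ≤ z → x < z
  <-≤-trans {z = z} x<y y≤z with <-cotrans x<y z
  ... | inj₁ x<z = x<z
  ... | inj₂ z<y = contradiction z<y y≤z

  ≤-<-trans : ∀ {x y z} → x ≤ y → y < z → x < z
  ≤-<-trans {x} x≤y y<z with <-cotrans y<z x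
  ... | inj₁ y<x = contradiction y<x x≤y
  ... | inj₂ x<z = x<z

  ≤-trans : ∀ {x y z} → x ≤ y → y ≤ z → x ≤ z
  ≤-trans x≤y y≤z z<x = y≤z (<-≤-trans z<x x≤y)

  -- Two refuted strict inequalities refute apartness, and tightness turns this into equality.
  ≤-antisym : ∀ {x y} → x ≤ y → y ≤ x → x ≈ y
  ≤-antisym {x} {y} x≤y y≤x = proj₁ (tight x y) ([ y≤x , x≤y ]′ ∘ #⇒<⊎>)

  ≤-isPreorder : IsPreorder _≈_ _≤_
  ≤-isPreorder = record
    { isEquivalence = isEquivalence
    ; reflexive     = ≤-reflexive
    ; trans         = ≤-trans
    }

  module ≤-Reasoning = Triple ≤-isPreorder
    <-Order.asym <-Order.trans <-Order.<-resp-≈ <⇒≤ <-≤-trans ≤-<-trans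
  open ≤-Reasoning

  -x+[x+y]≈y : ∀ x y → - x + (x + y) ≈ y
  -x+[x+y]≈y x y = trans (sym (+-assoc _ _ _)) (trans (+-congʳ (-‿inverseˡ x)) (+-identityˡ y))

  x+[y-x]≈y : ∀ x y → x + (y - x) ≈ y
  x+[y-x]≈y x y = trans (sym (+-assoc x y (- x))) (trans (+-congʳ (+-comm x y))
    (trans (+-assoc y x (- x)) (trans (+-congˡ (-‿inverseʳ x)) (+-identityʳ y))))

  +-cancelˡ-< : ∀ x {y z} → x + y < x + z → y < z
  +-cancelˡ-< x {y} {z} x+y<x+z = begin-strict
    y               ≈⟨ -x+[x+y]≈y x y ⟨
    - x + (x + y)   <⟨ +-monoʳ-< (- x) x+y<x+z ⟩
    - x + (x + z)   ≈⟨ -x+[x+y]≈y x z ⟩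
    z               ∎

  +-monoʳ-≤ : ∀ x {y z} → y ≤ z → x + y ≤ x + z
  +-monoʳ-≤ x y≤z = y≤z ∘ +-cancelˡ-< x

  +-cancelˡ-≤ : ∀ x {y z} → x + y ≤ x + z → y ≤ z
  +-cancelˡ-≤ x x+y≤x+z = x+y≤x+z ∘ +-monoʳ-< x

  +-mono-≤ : ∀ {x y u v} → x ≤ y → u ≤ v → x + u ≤ y + v
  +-mono-≤ {x} {y} {u} {v} x≤y u≤v = begin
    x + u  ≤⟨ +-monoʳ-≤ x u≤v ⟩
    x + v  ≈⟨ +-comm x v ⟩
    v + x  ≤⟨ +-monoʳ-≤ v x≤y ⟩
    v + y  ≈⟨ +-comm v y ⟩
    y + v  ∎

  +-cancelʳ-≤ : ∀ x {y z} → y + x ≤ z + x → y ≤ z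
  +-cancelʳ-≤ x {y} {z} y+x≤z+x = +-cancelˡ-≤ x (begin
    x + y  ≈⟨ +-comm x y ⟩
    y + x  ≤⟨ y+x≤z+x ⟩
    z + x  ≈⟨ +-comm z x ⟩
    x + z  ∎)

  x<y⇒0<y-x : ∀ {x y} → x < y → 0# < y - x
  x<y⇒0<y-x {x} {y} x<y = +-cancelˡ-< x (begin-strict
    x + 0#       ≈⟨ +-identityʳ x ⟩
    x            <⟨ x<y ⟩
    y            ≈⟨ x+[y-x]≈y x y ⟨
    x + (y - x)  ∎)

  x≤y⇒0≤y-x : ∀ {x y} → x ≤ y → 0# ≤ y - x
  x≤y⇒0≤y-x {x} {y} x≤y = +-cancelˡ-≤ x (begin
    x + 0#       ≈⟨ +-identityʳ x ⟩
    x            ≤⟨ x≤y ⟩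
    y            ≈⟨ x+[y-x]≈y x y ⟨
    x + (y - x)  ∎)

  *-monoʳ-< : ∀ {x y z} → 0# < x → y < z → x * y < x * z
  *-monoʳ-< {x} {y} {z} 0<x y<z = begin-strict
    x * y                ≈⟨ +-identityʳ _ ⟨
    x * y + 0#           <⟨ +-monoʳ-< (x * y) (*-pos 0<x (x<y⇒0<y-x y<z)) ⟩
    x * y + x * (z - y)  ≈⟨ distribˡ x y (z - y) ⟨
    x * (y + (z - y))    ≈⟨ *-congˡ (x+[y-x]≈y y z) ⟩
    x * z                ∎

  *-cancelˡ-≤ : ∀ {x y z} → 0# < x → x * y ≤ x * z → y ≤ z
  *-cancelˡ-≤ 0<x xy≤xz = xy≤xz ∘ *-monoʳ-< 0<x

  -- A nonnegative x need not split into zero or positive, so a negative product is assumed and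
  -- refuted. A positive x would force y, and with it the product, to be zero; hence x itself is
  -- zero, and the product vanishes after all.
  *-nonNeg : ∀ {x y} → 0# ≤ x → 0# ≤ y → 0# ≤ x * y
  *-nonNeg {x} {y} 0≤x 0≤y xy<0 = <-Order.irrefl xy≈0 xy<0
    where
    0≮x : ¬ 0# < x
    0≮x 0<x = <-Order.irrefl (trans (*-congˡ y≈0) (zeroʳ x)) xy<0
      where
      y≈0 : y ≈ 0#
      y≈0 = ≤-antisym (λ 0<y → <-Order.asym xy<0 (*-pos 0<x 0<y)) 0≤y
    xy≈0 : x * y ≈ 0#
    xy≈0 = trans (*-congʳ (≤-antisym 0≮x 0≤x)) (zeroˡ y)

  *-monoʳ-≤ : ∀ {x y z} → 0# ≤ x → y ≤ z → x * y ≤ x * z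
  *-monoʳ-≤ {x} {y} {z} 0≤x y≤z = begin
    x * y                ≈⟨ +-identityʳ _ ⟨
    x * y + 0#           ≤⟨ +-monoʳ-≤ (x * y) (*-nonNeg 0≤x (x≤y⇒0≤y-x y≤z)) ⟩
    x * y + x * (z - y)  ≈⟨ distribˡ x y (z - y) ⟨
    x * (y + (z - y))    ≈⟨ *-congˡ (x+[y-x]≈y y z) ⟩
    x * z                ∎

  *-monoˡ-≤ : ∀ {x y z} → 0# ≤ x → y ≤ z → y * x ≤ z * x
  *-monoˡ-≤ {x} {y} {z} 0≤x y≤z = begin
    y * x  ≈⟨ *-comm y x ⟩
    x * y  ≤⟨ *-monoʳ-≤ 0≤x y≤z ⟩
    x * z  ≈⟨ *-comm x z ⟩
    z * x  ∎

  *-mono-≤ : ∀ {x y u v} → 0# ≤ x → 0# ≤ v → x ≤ y → u ≤ v → x * u ≤ y * v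
  *-mono-≤ 0≤x 0≤v x≤y u≤v = ≤-trans (*-monoʳ-≤ 0≤x u≤v) (*-monoˡ-≤ 0≤v x≤y)

  -- If the square were negative, x could not be negative, since `- x` would be positive with the
  -- same square. So x is nonnegative, and `*-nonNeg` gives the contradiction.
  square-nonNeg : ∀ x → 0# ≤ x * x
  square-nonNeg x xx<0 = *-nonNeg 0≤x 0≤x xx<0
    where
    -x*-x≈xx : - x * - x ≈ x * x
    -x*-x≈xx = trans (sym (-‿distribˡ-* x (- x)))
      (trans (-‿cong (sym (-‿distribʳ-* x x))) (-‿involutive (x * x)))
    0≤x : 0# ≤ x
    0≤x x<0 = <-Order.asym xx<0 (begin-strict
      0#         <⟨ *-pos 0<-x 0<-x ⟩
      - x * - x  ≈⟨ -x*-x≈xx ⟩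
      x * x      ∎)
      where
      0<-x : 0# < - x
      0<-x = begin-strict
        0#       <⟨ x<y⇒0<y-x x<0 ⟩
        0# - x   ≈⟨ +-identityˡ (- x) ⟩
        - x      ∎

  ^-nonNeg : ∀ {x} n → 0# ≤ x → 0# ≤ x ^ n
  ^-nonNeg zero    0≤x = <⇒≤ 0<1
  ^-nonNeg (suc n) 0≤x = *-nonNeg 0≤x (^-nonNeg n 0≤x)

  ^-monoˡ-≤ : ∀ n {x y} → 0# ≤ x → x ≤ y → x ^ n ≤ y ^ n
  ^-monoˡ-≤ zero    0≤x x≤y = ≤-reflexive refl
  ^-monoˡ-≤ (suc n) 0≤x x≤y =
    *-mono-≤ 0≤x (^-nonNeg n (≤-trans 0≤x x≤y)) x≤y (^-monoˡ-≤ n 0≤x x≤y)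

  ^-even-nonNeg : ∀ x j → 0# ≤ x ^ (j ℕ.* 2)
  ^-even-nonNeg x zero    = <⇒≤ 0<1
  ^-even-nonNeg x (suc j) = begin
    0#                          ≤⟨ *-nonNeg (square-nonNeg x) (^-even-nonNeg x j) ⟩
    x * x * x ^ (j ℕ.* 2)       ≈⟨ *-assoc x x _ ⟩
    x * (x * x ^ (j ℕ.* 2))     ∎

  -- No case split on the sign of x is available. If the conclusion fails, then x < 0 is refuted: it
  -- makes the odd power of x at most 0 and so pushes the power of y below 0. Hence x is
  -- nonnegative, and `^-monoˡ-≤` applies.
  ^-odd-mono-≤ : ∀ j {x y} → 0# ≤ y → x ≤ y → x ^ suc (j ℕ.* 2) ≤ y ^ suc (j ℕ.* 2)
  ^-odd-mono-≤ j {x} {y} 0≤y x≤y y^m<x^m =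
    ^-monoˡ-≤ (suc (j ℕ.* 2)) 0≤x x≤y y^m<x^m
    where
    0≤x : 0# ≤ x
    0≤x x<0 = ^-nonNeg (suc (j ℕ.* 2)) 0≤y (begin-strict
      y ^ suc (j ℕ.* 2)   <⟨ y^m<x^m ⟩
      x * x ^ (j ℕ.* 2)   ≤⟨ *-monoˡ-≤ (^-even-nonNeg x j) (<⇒≤ x<0) ⟩
      0# * x ^ (j ℕ.* 2)  ≈⟨ zeroˡ _ ⟩
      0#                  ∎)

  ·-mono-≤ : ∀ n {x y} → x ≤ y → n · x ≤ n · y
  ·-mono-≤ zero    x≤y = ≤-reflexive refl
  ·-mono-≤ (suc n) x≤y = +-mono-≤ x≤y (·-mono-≤ n x≤y)

  ·-mono-< : ∀ n .{{_ : NonZero n}} {x y} → x < y → n · x < n · y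
  ·-mono-< (suc n) {x} {y} x<y = begin-strict
    x + n · x  ≤⟨ +-monoʳ-≤ x (·-mono-≤ n (<⇒≤ x<y)) ⟩
    x + n · y  ≈⟨ +-comm x _ ⟩
    n · y + x  <⟨ +-monoʳ-< (n · y) x<y ⟩
    n · y + y  ≈⟨ +-comm _ y ⟩
    y + n · y  ∎

  ·-cancel-≤ : ∀ n .{{_ : NonZero n}} {x y} → n · x ≤ n · y → x ≤ y
  ·-cancel-≤ n nx≤ny = nx≤ny ∘ ·-mono-< n

  ·1-* : ∀ n x → (n · 1#) * x ≈ n · x
  ·1-* n x = trans (×-assoc-* n 1# x) (·-congˡ n (*-identityˡ x))

  ·-comm : ∀ m n x → m · (n · x) ≈ n · (m · x)
  ·-comm m n x = trans (·-congˡ m (sym (·1-* n x)))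
    (trans (sym (×-comm-* m (n · 1#) x)) (·1-* n (m · x)))

  ·-/ : ∀ n .{{_ : NonZero n}} x → n · (x / n) ≈ x
  ·-/ n x = trans (sym (×-comm-* n x _)) (trans (*-congˡ (sym (·1-* n _)))
    (trans (*-congˡ (proj₂ (proj₂ (ℕ-invertible n)))) (*-identityʳ x)))

  x≤y/n⇒n·x≤y : ∀ n .{{_ : NonZero n}} {x y} → x ≤ y / n → n · x ≤ y
  x≤y/n⇒n·x≤y n {x} {y} x≤y/n = begin
    n · x        ≤⟨ ·-mono-≤ n x≤y/n ⟩
    n · (y / n)  ≈⟨ ·-/ n y ⟩
    y            ∎

  n·x≤y⇒x≤y/n : ∀ n .{{_ : NonZero n}} {x y} → n · x ≤ y → x ≤ y / n
  n·x≤y⇒x≤y/n n {x} {y} n·x≤y = ·-cancel-≤ n (begin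
    n · x        ≤⟨ n·x≤y ⟩
    y            ≈⟨ ·-/ n y ⟨
    n · (y / n)  ∎)

-- The second inequality: powers of 1 - 2ε.

-- By induction on m, (m + 1) ε + A ^ m ≤ 1 as long as A ^ m ≥ 1 / 2: the step
-- loses A ^ m - A ^ (m + 1) = 2 ε A ^ m ≥ ε.
module PowerBound {c ℓ₁ ℓ₂ ℓ₃} (K : OrderedField c ℓ₁ ℓ₂ ℓ₃) where
  open OrderedField K hiding (zero)
  open OrderedFieldProperties K
  open ≤-Reasoning

  -- A is 1 - 2ε, specified by an equation without subtraction so that terms can be rearranged as in
  -- a semiring.
  module _ {A ε : Carrier} (0≤A : 0# ≤ A) (0<ε : 0# < ε) (A+2ε≈1 : A + 2 · ε ≈ 1#) where

    ^-split : ∀ m → A ^ m ≈ A ^ suc m + A ^ m * (2 · ε)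
    ^-split m = begin-equality
      A ^ m                            ≈⟨ *-identityʳ _ ⟨
      A ^ m * 1#                       ≈⟨ *-congˡ A+2ε≈1 ⟨
      A ^ m * (A + 2 · ε)              ≈⟨ distribˡ _ _ _ ⟩
      A ^ m * A + A ^ m * (2 · ε)      ≈⟨ +-congʳ (*-comm _ _) ⟩
      A ^ suc m + A ^ m * (2 · ε)      ∎

    0≤2ε : 0# ≤ 2 · ε
    0≤2ε = begin
      0#      ≈⟨ +-identityʳ 0# ⟨
      0# + 0# ≈⟨ +-congˡ (+-identityʳ 0#) ⟨
      2 · 0#  ≤⟨ ·-mono-≤ 2 (<⇒≤ 0<ε) ⟩
      2 · ε   ∎

    ^-antitone : ∀ m → A ^ suc m ≤ A ^ m
    ^-antitone m = begin
      A ^ suc m                        ≈⟨ +-identityʳ _ ⟨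
      A ^ suc m + 0#                   ≤⟨ +-monoʳ-≤ _ (*-nonNeg (^-nonNeg m 0≤A) 0≤2ε) ⟩
      A ^ suc m + A ^ m * (2 · ε)      ≈⟨ ^-split m ⟨
      A ^ m                            ∎

    suc-·ε+^≤1 : ∀ m → 1# ≤ 2 · A ^ suc m → suc (suc m) · ε + A ^ suc m ≤ 1#
    suc-·ε+^≤1 zero    _      = ≤-reflexive (begin-equality
      2 · ε + A * 1#  ≈⟨ +-congˡ (*-identityʳ A) ⟩
      2 · ε + A       ≈⟨ +-comm _ _ ⟩
      A + 2 · ε       ≈⟨ A+2ε≈1 ⟩
      1#              ∎)
    suc-·ε+^≤1 (suc m) 1≤2A^ = begin
      ε + suc (suc m) · ε + A ^ suc (suc m)
        ≈⟨ solve 3 (λ x y z → x :+ y :+ z := y :+ (z :+ x)) refl ε _ _ ⟩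
      suc (suc m) · ε + (A ^ suc (suc m) + ε)
        ≤⟨ +-monoʳ-≤ _ (+-monoʳ-≤ _ ε≤A^*2ε) ⟩
      suc (suc m) · ε + (A ^ suc (suc m) + A ^ suc m * (2 · ε))
        ≈⟨ +-congˡ (^-split (suc m)) ⟨
      suc (suc m) · ε + A ^ suc m
        ≤⟨ suc-·ε+^≤1 m 1≤2A^m ⟩
      1# ∎
      where
      -- Powers of A do not increase, so the lower bound passes from the larger exponent to the
      -- smaller one.
      1≤2A^m : 1# ≤ 2 · A ^ suc m
      1≤2A^m = ≤-trans 1≤2A^ (·-mono-≤ 2 (^-antitone (suc m)))
      ε≤A^*2ε : ε ≤ A ^ suc m * (2 · ε)
      ε≤A^*2ε = begin
        ε                    ≈⟨ *-identityˡ ε ⟨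
        1# * ε               ≤⟨ *-monoˡ-≤ (<⇒≤ 0<ε) 1≤2A^m ⟩
        2 · A ^ suc m * ε    ≈⟨ trans (×-assoc-* 2 _ ε) (sym (×-comm-* 2 _ ε)) ⟩
        A ^ suc m * (2 · ε)  ∎

    -- Whether the power of A is at least 1/2 cannot be decided. But if p, the right side, is below
    -- the minimum, then p < 1/4 forces this, so `suc-·ε+^≤1` yields (m + 2) ε / 2 ≤ p, against p
    -- being below the minimum.
    ⊓-≤-half : ∀ m → (1# / 4) ⊓ ((suc (suc m) · ε) / 2) ≤ (1# - A ^ suc m) / 2
    ⊓-≤-half m p<⊓ = k·ε/2≤p (<-≤-trans p<⊓ (proj₁ (proj₂ (⊓-infimum _ _))))
      where
      p = (1# - A ^ suc m) / 2
      2p+A^≈1 : 2 · p + A ^ suc m ≈ 1#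
      2p+A^≈1 = trans (+-congʳ (·-/ 2 _)) (trans (+-assoc _ _ _)
        (trans (+-congˡ (-‿inverseˡ _)) (+-identityʳ 1#)))
      4p≤1 : 4 · p ≤ 1#
      4p≤1 = begin
        4 · p         ≤⟨ ·-mono-≤ 4 (<⇒≤ (<-≤-trans p<⊓ (proj₁ (⊓-infimum _ _)))) ⟩
        4 · (1# / 4)  ≈⟨ ·-/ 4 1# ⟩
        1#            ∎
      -- Doubling `2p+A^≈1` writes 2 as 4p plus twice the power, and 4p takes up at most 1 of it.
      1≤2A^ : 1# ≤ 2 · A ^ suc m
      1≤2A^ = +-cancelˡ-≤ 1# (begin
        1# + 1#                       ≈⟨ +-cong 2p+A^≈1 2p+A^≈1 ⟨
        (2 · p + A ^ suc m) + (2 · p + A ^ suc m)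
          ≈⟨ solve 2 (λ x y → let 2x = x :+ (x :+ con 0) in
               (2x :+ y) :+ (2x :+ y) := (x :+ (x :+ 2x)) :+ (y :+ (y :+ con 0))) refl p _ ⟩
        4 · p + 2 · A ^ suc m         ≤⟨ +-mono-≤ 4p≤1 (≤-reflexive refl) ⟩
        1# + 2 · A ^ suc m            ∎)
      k·ε/2≤p : (suc (suc m) · ε) / 2 ≤ p
      k·ε/2≤p = ·-cancel-≤ 2 (+-cancelʳ-≤ (A ^ suc m) (begin
        2 · ((suc (suc m) · ε) / 2) + A ^ suc m  ≈⟨ +-congʳ (·-/ 2 _) ⟩
        suc (suc m) · ε + A ^ suc m              ≤⟨ suc-·ε+^≤1 m 1≤2A^ ⟩
        1#                                       ≈⟨ 2p+A^≈1 ⟨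
        2 · p + A ^ suc m                        ∎))

-- Finite sums over lists, and correlation of sign functions.

module Sums {c ℓ₁ ℓ₂ ℓ₃} (K : OrderedField c ℓ₁ ℓ₂ ℓ₃) where
  open OrderedField K hiding (zero)
  open OrderedFieldProperties K
  open ≤-Reasoning

  infix 7 ∑

  ∑ : List A → (A → Carrier) → Carrier
  ∑ []       f = 0#
  ∑ (x ∷ xs) f = f x + ∑ xs f

  syntax ∑ Ω (λ x → e) = ∑[ x ∈ Ω ] e

  size : List A → Carrier
  size Ω = length Ω · 1#

  ∑-cong : ∀ (Ω : List A) {f g : A → Carrier} → (∀ x → f x ≈ g x) → ∑ Ω f ≈ ∑ Ω g
  ∑-cong []      f≈g = refl
  ∑-cong (x ∷ Ω) f≈g = +-cong (f≈g x) (∑-cong Ω f≈g)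

  ∑-mono-≤ : ∀ (Ω : List A) {f g : A → Carrier} → (∀ x → f x ≤ g x) → ∑ Ω f ≤ ∑ Ω g
  ∑-mono-≤ []      f≤g = ≤-reflexive refl
  ∑-mono-≤ (x ∷ Ω) f≤g = +-mono-≤ (f≤g x) (∑-mono-≤ Ω f≤g)

  ∑-0 : ∀ (Ω : List A) → ∑[ _ ∈ Ω ] 0# ≈ 0#
  ∑-0 []      = refl
  ∑-0 (x ∷ Ω) = trans (+-identityˡ _) (∑-0 Ω)

  ∑-1 : ∀ (Ω : List A) → ∑[ _ ∈ Ω ] 1# ≈ size Ω
  ∑-1 []      = refl
  ∑-1 (x ∷ Ω) = +-congˡ (∑-1 Ω)

  ∑-+ : ∀ (Ω : List A) (f g : A → Carrier) → ∑[ x ∈ Ω ] (f x + g x) ≈ ∑ Ω f + ∑ Ω g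
  ∑-+ []      f g = sym (+-identityˡ 0#)
  ∑-+ (x ∷ Ω) f g = trans (+-congˡ (∑-+ Ω f g)) (interchange (f x) (g x) (∑ Ω f) (∑ Ω g))
    where open CommutativeSemigroupProperties +-commutativeSemigroup using (interchange)

  *-distribˡ-∑ : ∀ (Ω : List A) y (f : A → Carrier) → y * ∑ Ω f ≈ ∑[ x ∈ Ω ] (y * f x)
  *-distribˡ-∑ []      y f = zeroʳ y
  *-distribˡ-∑ (x ∷ Ω) y f = trans (distribˡ y _ _) (+-congˡ (*-distribˡ-∑ Ω y f))

  *-distribʳ-∑ : ∀ (Ω : List A) y (f : A → Carrier) → ∑ Ω f * y ≈ ∑[ x ∈ Ω ] (f x * y)
  *-distribʳ-∑ Ω y f = trans (*-comm _ y)
    (trans (*-distribˡ-∑ Ω y f) (∑-cong Ω (λ x → *-comm y (f x))))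

  ∑-*-∑ : ∀ (Ω : List A) (Ψ : List B) f g →
          ∑ Ω f * ∑ Ψ g ≈ ∑[ x ∈ Ω ] ∑[ y ∈ Ψ ] (f x * g y)
  ∑-*-∑ Ω Ψ f g = trans (*-distribʳ-∑ Ω _ f) (∑-cong Ω (λ x → *-distribˡ-∑ Ψ (f x) g))

  ∑-comm : ∀ (Ω : List A) (Ψ : List B) (f : A → B → Carrier) →
           ∑[ x ∈ Ω ] ∑[ y ∈ Ψ ] f x y ≈ ∑[ y ∈ Ψ ] ∑[ x ∈ Ω ] f x y
  ∑-comm []      Ψ f = sym (∑-0 Ψ)
  ∑-comm (x ∷ Ω) Ψ f = trans (+-congˡ (∑-comm Ω Ψ f)) (sym (∑-+ Ψ _ _))

  ∑-++ : ∀ (Ω Ψ : List A) f → ∑ (Ω ++ Ψ) f ≈ ∑ Ω f + ∑ Ψ f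
  ∑-++ []      Ψ f = sym (+-identityˡ _)
  ∑-++ (x ∷ Ω) Ψ f = trans (+-congˡ (∑-++ Ω Ψ f)) (sym (+-assoc _ _ _))

  ∑-map : ∀ (g : A → B) Ω f → ∑ (map g Ω) f ≈ ∑[ x ∈ Ω ] f (g x)
  ∑-map g []      f = refl
  ∑-map g (x ∷ Ω) f = +-congˡ (∑-map g Ω f)

  ∑-tuples : ∀ (Ω : List A) k f →
             ∑ (tuples Ω (suc k)) f ≈ ∑[ x ∈ Ω ] ∑[ xs ∈ tuples Ω k ] f (x ∷ xs)
  ∑-tuples {A = A} Ω k f = go Ω
    where
    Ψ = tuples Ω k
    -- Only the list of heads shrinks in the induction; the tails keep ranging over tuples from all
    -- of Ω.
    go : ∀ (Φ : List A) → ∑ (cartesianProductWith _∷_ Φ Ψ) f ≈ ∑[ x ∈ Φ ] ∑[ xs ∈ Ψ ] f (x ∷ xs)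
    go []      = refl
    go (x ∷ Φ) = trans (∑-++ (map (x ∷_) Ψ) _ f) (+-cong (∑-map (x ∷_) Ψ f) (go Φ))

  -- Counting is summing ones: splitting off the first entry gives a double sum of `1# * 1#`, which
  -- factors.
  size-tuples : ∀ (Ω : List A) k → size (tuples Ω k) ≈ size Ω ^ k
  size-tuples Ω zero    = +-identityʳ 1#
  size-tuples Ω (suc k) = begin-equality
    size (tuples Ω (suc k))                   ≈⟨ ∑-1 (tuples Ω (suc k)) ⟨
    ∑[ _ ∈ tuples Ω (suc k) ] 1#              ≈⟨ ∑-tuples Ω k _ ⟩
    ∑[ _ ∈ Ω ] ∑[ _ ∈ tuples Ω k ] 1#
      ≈⟨ ∑-cong Ω (λ _ → ∑-cong (tuples Ω k) (λ _ → *-identityˡ 1#)) ⟨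
    ∑[ _ ∈ Ω ] ∑[ _ ∈ tuples Ω k ] (1# * 1#)  ≈⟨ ∑-*-∑ Ω (tuples Ω k) _ _ ⟨
    (∑[ _ ∈ Ω ] 1#) * (∑[ _ ∈ tuples Ω k ] 1#)
      ≈⟨ *-cong (∑-1 Ω) (trans (∑-1 (tuples Ω k)) (size-tuples Ω k)) ⟩
    size Ω * size Ω ^ k                       ∎

  ⟦_⟧ : Sign → Carrier
  ⟦ S.+ ⟧ = 1#
  ⟦ S.- ⟧ = - 1#

  ⟦opposite⟧ : ∀ s → ⟦ S.opposite s ⟧ ≈ - ⟦ s ⟧
  ⟦opposite⟧ S.+ = refl
  ⟦opposite⟧ S.- = sym (-‿involutive 1#)

  ⟦⟧-homo-* : ∀ s t → ⟦ s S.* t ⟧ ≈ ⟦ s ⟧ * ⟦ t ⟧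
  ⟦⟧-homo-* S.+ t = sym (*-identityˡ ⟦ t ⟧)
  ⟦⟧-homo-* S.- t = trans (⟦opposite⟧ t) (sym (-1*x≈-x ⟦ t ⟧))

  ⟦s*s⟧≈1 : ∀ s → ⟦ s S.* s ⟧ ≈ 1#
  ⟦s*s⟧≈1 s = reflexive (≡.cong ⟦_⟧ (S.s*s≡+ s))

  -- An agreement contributes 1 and a disagreement -1 + 2 = 1. This serves twice: for the distance
  -- of f to a character, and for the number of rejected tuples.
  correlation+2·disagreement≈size : ∀ (Ω : List A) (s t : A → Sign) →
    ∑[ x ∈ Ω ] ⟦ s x S.* t x ⟧ + 2 · size (filter (λ x → ¬? (s x S.≟ t x)) Ω) ≈ size Ω
  correlation+2·disagreement≈size []      s t =
    trans (+-identityˡ _) (trans (+-identityˡ _) (+-identityˡ _))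
  correlation+2·disagreement≈size (x ∷ Ω) s t
    with s x S.≟ t x | correlation+2·disagreement≈size Ω s t
  ... | yes s≡t | ih = begin-equality
    ⟦ s x S.* t x ⟧ + C + 2 · D
      ≈⟨ +-congʳ (+-congʳ (reflexive (≡.cong (λ r → ⟦ s x S.* r ⟧) (≡.sym s≡t)))) ⟩
    ⟦ s x S.* s x ⟧ + C + 2 · D    ≈⟨ +-congʳ (+-congʳ (⟦s*s⟧≈1 (s x))) ⟩
    1# + C + 2 · D                 ≈⟨ +-assoc 1# C _ ⟩
    1# + (C + 2 · D)               ≈⟨ +-congˡ ih ⟩
    1# + size Ω                    ∎
    where
    C = ∑[ y ∈ Ω ] ⟦ s y S.* t y ⟧
    D = size (filter (λ y → ¬? (s y S.≟ t y)) Ω)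
  ... | no s≢t | ih = begin-equality
    ⟦ s x S.* t x ⟧ + C + 2 · (1# + D)
      ≈⟨ +-congʳ (+-congʳ (reflexive (≡.cong ⟦_⟧ (s*t≡- (s x) (t x) s≢t)))) ⟩
    - 1# + C + 2 · (1# + D)
      ≈⟨ solve 4 (λ i j C D → i :+ C :+ ((j :+ D) :+ ((j :+ D) :+ con 0)) :=
           (i :+ j) :+ (j :+ (C :+ (D :+ (D :+ con 0))))) refl (- 1#) 1# C D ⟩
    (- 1# + 1#) + (1# + (C + 2 · D))    ≈⟨ +-congʳ (-‿inverseˡ 1#) ⟩
    0# + (1# + (C + 2 · D))             ≈⟨ +-identityˡ _ ⟩
    1# + (C + 2 · D)                    ≈⟨ +-congˡ ih ⟩
    1# + size Ω                         ∎
    where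
    C = ∑[ y ∈ Ω ] ⟦ s y S.* t y ⟧
    D = size (filter (λ y → ¬? (s y S.≟ t y)) Ω)
    s*t≡- : ∀ s t → ¬ s ≡ t → s S.* t ≡ S.-
    s*t≡- S.+ S.+ s≢t = contradiction ≡.refl s≢t
    s*t≡- S.+ S.- s≢t = ≡.refl
    s*t≡- S.- S.+ s≢t = ≡.refl
    s*t≡- S.- S.- s≢t = contradiction ≡.refl s≢t

-- Characters of the cube.

signOf : Bool → Sign
signOf false = S.+
signOf true  = S.-

-- The character x ↦ (-1)^(Σᵢ Sᵢ xᵢ).
χ : ∀ {n} → Cube n → Cube n → Sign
χ []      []      = S.+
χ (s ∷ S) (b ∷ x) = signOf (s ∧ b) S.* χ S x

signOf-∧-xor : ∀ s b c → signOf (s ∧ b) S.* signOf (s ∧ c) ≡ signOf (s ∧ (b xor c))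
signOf-∧-xor false b     c     = ≡.refl
signOf-∧-xor true  false c     = ≡.refl
signOf-∧-xor true  true  false = ≡.refl
signOf-∧-xor true  true  true  = ≡.refl

-- Signs regroup coordinate by coordinate, which leaves the one-bit case. It lets farness be applied
-- to every character, and lets products of characters merge in `F-^`.
χ-linear : ∀ {n} (S : Cube n) → Linear (χ S)
χ-linear []      []      []      = ≡.refl
χ-linear (s ∷ S) (b ∷ x) (c ∷ y) = ≡.trans
  (interchange (signOf (s ∧ b)) (χ S x) (signOf (s ∧ c)) (χ S y))
  (≡.cong₂ S._*_ (signOf-∧-xor s b c) (χ-linear S x y))
  where open CommutativeSemigroupProperties S.*-commutativeSemigroup using (interchange)

χ-replicate-false : ∀ {n} (S : Cube n) → χ S (Vec.replicate n false) ≡ S.+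
χ-replicate-false []          = ≡.refl
χ-replicate-false (false ∷ S) = χ-replicate-false S
χ-replicate-false (true  ∷ S) = χ-replicate-false S

-- Fourier analysis on the cube.

module Fourier {c ℓ₁ ℓ₂ ℓ₃} (K : OrderedField c ℓ₁ ℓ₂ ℓ₃) where
  open OrderedField K hiding (zero)
  open OrderedFieldProperties K
  open Sums K
  open ≤-Reasoning

  -- The Fourier coefficient of f at S, multiplied by 2 ^ n.
  F : ∀ {n} → (Cube n → Sign) → Cube n → Carrier
  F {n} f S = ∑[ x ∈ cube n ] ⟦ f x S.* χ S x ⟧

  ∑-cube-suc : ∀ n (f : Cube (suc n) → Carrier) →
    ∑ (cube (suc n)) f ≈ ∑[ x ∈ cube n ] f (false ∷ x) + ∑[ x ∈ cube n ] f (true ∷ x)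
  ∑-cube-suc n f = trans (∑-tuples (false ∷ true ∷ []) n f) (+-congˡ (+-identityʳ _))

  -- Together with `F-true`, the butterfly step of the Walsh-Hadamard transform: coefficients of f
  -- are sums and differences of those of its two halves.
  F-false : ∀ {n} (f : Cube (suc n) → Sign) S →
            F f (false ∷ S) ≈ F (f ∘ (false ∷_)) S + F (f ∘ (true ∷_)) S
  F-false {n} f S = ∑-cube-suc n _

  F-true : ∀ {n} (f : Cube (suc n) → Sign) S →
           F f (true ∷ S) ≈ F (f ∘ (false ∷_)) S - F (f ∘ (true ∷_)) S
  F-true {n} f S = trans (∑-cube-suc n _) (+-congˡ (begin-equality
    ∑[ x ∈ cube n ] ⟦ f₁ x S.* S.opposite (χ S x) ⟧
      ≈⟨ ∑-cong (cube n) (λ x → negate (f₁ x) (χ S x)) ⟩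
    ∑[ x ∈ cube n ] (- 1# * ⟦ f₁ x S.* χ S x ⟧)      ≈⟨ *-distribˡ-∑ (cube n) _ _ ⟨
    - 1# * F f₁ S                                    ≈⟨ -1*x≈-x _ ⟩
    - F f₁ S                                         ∎))
    where
    f₁ = f ∘ (true ∷_)
    s*opposite[t] : ∀ s t → s S.* S.opposite t ≡ S.opposite (s S.* t)
    s*opposite[t] S.+ t = ≡.refl
    s*opposite[t] S.- t = ≡.refl
    negate : ∀ s t → ⟦ s S.* S.opposite t ⟧ ≈ - 1# * ⟦ s S.* t ⟧
    negate s t = trans (reflexive (≡.cong ⟦_⟧ (s*opposite[t] s t))) (⟦⟧-homo-* S.- (s S.* t))

  -- Induction on n. Pairing the sets `false ∷ S` and `true ∷ S`, the half of f that does not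
  -- contain z cancels and the other half counts twice.
  inversion : ∀ n (f : Cube n → Sign) z →
              ∑[ S ∈ cube n ] (⟦ χ S z ⟧ * F f S) ≈ size (cube n) * ⟦ f z ⟧
  inversion n f z = begin-equality
    ∑[ S ∈ cube n ] (⟦ χ S z ⟧ * F f S)   ≈⟨ go n f z ⟩
    ∑[ _ ∈ cube n ] ⟦ f z ⟧               ≈⟨ ∑-cong (cube n) (λ _ → *-identityˡ _) ⟨
    ∑[ _ ∈ cube n ] (1# * ⟦ f z ⟧)        ≈⟨ *-distribʳ-∑ (cube n) _ _ ⟨
    (∑[ _ ∈ cube n ] 1#) * ⟦ f z ⟧        ≈⟨ *-congʳ (∑-1 (cube n)) ⟩
    size (cube n) * ⟦ f z ⟧               ∎
    where
    -- The cancellation when the first bit of z is `false`; `odd` treats `true` by exchanging x and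
    -- y.
    even : ∀ r x y → r * (x + y) + r * (x - y) ≈ r * x + r * x
    even r x y = begin-equality
      r * (x + y) + r * (x - y)
        ≈⟨ solve 4 (λ r x y y′ → r :* (x :+ y) :+ r :* (x :+ y′) :=
             r :* x :+ r :* x :+ r :* (y :+ y′)) refl r x y (- y) ⟩
      r * x + r * x + r * (y - y)  ≈⟨ +-congˡ (trans (*-congˡ (-‿inverseʳ y)) (zeroʳ r)) ⟩
      r * x + r * x + 0#           ≈⟨ +-identityʳ _ ⟩
      r * x + r * x                ∎
    odd : ∀ r x y → r * (x + y) + - r * (x - y) ≈ r * y + r * y
    odd r x y = begin-equality
      r * (x + y) + - r * (x - y)    ≈⟨ +-cong (*-congˡ (+-comm x y)) (sym (-‿distribˡ-* r _)) ⟩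
      r * (y + x) + - (r * (x - y))
        ≈⟨ +-congˡ (trans (-‿distribʳ-* r _) (*-congˡ (⁻¹-anti-homo‿- x y))) ⟩
      r * (y + x) + r * (y - x)      ≈⟨ even r y x ⟩
      r * y + r * y                  ∎
    step : ∀ {n} (f : Cube (suc n) → Sign) b z S →
           ⟦ χ (false ∷ S) (b ∷ z) ⟧ * F f (false ∷ S) + ⟦ χ (true ∷ S) (b ∷ z) ⟧ * F f (true ∷ S)
           ≈ ⟦ χ S z ⟧ * F (f ∘ (b ∷_)) S + ⟦ χ S z ⟧ * F (f ∘ (b ∷_)) S
    step f false z S =
      trans (+-cong (*-congˡ (F-false f S)) (*-congˡ (F-true f S))) (even _ _ _)
    step f true  z S =
      trans (+-cong (*-congˡ (F-false f S)) (*-cong (⟦opposite⟧ (χ S z)) (F-true f S))) (odd _ _ _)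
    -- The right side stays a sum of a constant, since it then splits over the two halves of the
    -- cube just as the left side does.
    go : ∀ n (f : Cube n → Sign) z →
         ∑[ S ∈ cube n ] (⟦ χ S z ⟧ * F f S) ≈ ∑[ _ ∈ cube n ] ⟦ f z ⟧
    go zero    f []      = +-congʳ (begin-equality
      1# * (⟦ f [] S.* S.+ ⟧ + 0#)  ≈⟨ *-identityˡ _ ⟩
      ⟦ f [] S.* S.+ ⟧ + 0#         ≈⟨ +-identityʳ _ ⟩
      ⟦ f [] S.* S.+ ⟧              ≡⟨ ≡.cong ⟦_⟧ (S.*-identityʳ (f [])) ⟩
      ⟦ f [] ⟧                      ∎)
    go (suc n) f (b ∷ z) = begin-equality
      ∑[ S ∈ cube (suc n) ] (⟦ χ S (b ∷ z) ⟧ * F f S)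
        ≈⟨ ∑-cube-suc n _ ⟩
      ∑[ S ∈ cube n ] (⟦ χ (false ∷ S) (b ∷ z) ⟧ * F f (false ∷ S)) +
      ∑[ S ∈ cube n ] (⟦ χ (true ∷ S) (b ∷ z) ⟧ * F f (true ∷ S))
        ≈⟨ ∑-+ (cube n) _ _ ⟨
      ∑[ S ∈ cube n ] (⟦ χ (false ∷ S) (b ∷ z) ⟧ * F f (false ∷ S) +
                       ⟦ χ (true ∷ S) (b ∷ z) ⟧ * F f (true ∷ S))
        ≈⟨ ∑-cong (cube n) (step f b z) ⟩
      ∑[ S ∈ cube n ] (⟦ χ S z ⟧ * F (f ∘ (b ∷_)) S + ⟦ χ S z ⟧ * F (f ∘ (b ∷_)) S)
        ≈⟨ ∑-+ (cube n) _ _ ⟩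
      ∑[ S ∈ cube n ] (⟦ χ S z ⟧ * F (f ∘ (b ∷_)) S) +
      ∑[ S ∈ cube n ] (⟦ χ S z ⟧ * F (f ∘ (b ∷_)) S)
        ≈⟨ +-cong (go n (f ∘ (b ∷_)) z) (go n (f ∘ (b ∷_)) z) ⟩
      ∑[ _ ∈ cube n ] ⟦ f (b ∷ z) ⟧ + ∑[ _ ∈ cube n ] ⟦ f (b ∷ z) ⟧
        ≈⟨ ∑-cube-suc n _ ⟨
      ∑[ _ ∈ cube (suc n) ] ⟦ f (b ∷ z) ⟧ ∎

  -- Expanding the product of k sums gives one term per k-tuple, and the characters multiply into a
  -- single one at the XOR. The empty tuple gives 1 by `χ-replicate-false`.
  F-^ : ∀ {n} (f : Cube n → Sign) S k →
        F f S ^ k ≈ ∑[ xs ∈ tuples (cube n) k ] ⟦ ∏ (Vec.map f xs) S.* χ S (⨁ xs) ⟧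
  F-^     f S zero    = sym (trans (+-identityʳ _) (reflexive (≡.cong ⟦_⟧ (χ-replicate-false S))))
  F-^ {n} f S (suc k) = begin-equality
    F f S * F f S ^ k
      ≈⟨ *-congˡ (F-^ f S k) ⟩
    F f S * (∑[ xs ∈ tuples (cube n) k ] ⟦ ∏ (Vec.map f xs) S.* χ S (⨁ xs) ⟧)
      ≈⟨ ∑-*-∑ (cube n) (tuples (cube n) k) _ _ ⟩
    ∑[ x ∈ cube n ] ∑[ xs ∈ tuples (cube n) k ] (⟦ f x S.* χ S x ⟧ *
        ⟦ ∏ (Vec.map f xs) S.* χ S (⨁ xs) ⟧)
      ≈⟨ ∑-cong (cube n) (λ x → ∑-cong (tuples (cube n) k) (λ xs →
           regroup x (∏ (Vec.map f xs)) (⨁ xs))) ⟩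
    ∑[ x ∈ cube n ] ∑[ xs ∈ tuples (cube n) k ] ⟦ ∏ (Vec.map f (x ∷ xs)) S.* χ S (⨁ (x ∷ xs)) ⟧
      ≈⟨ ∑-tuples (cube n) k _ ⟨
    ∑[ xs ∈ tuples (cube n) (suc k) ] ⟦ ∏ (Vec.map f xs) S.* χ S (⨁ xs) ⟧ ∎
    where
    open CommutativeSemigroupProperties S.*-commutativeSemigroup using (interchange)
    regroup : ∀ x s y → ⟦ f x S.* χ S x ⟧ * ⟦ s S.* χ S y ⟧ ≈ ⟦ (f x S.* s) S.* χ S (x ⊕ y) ⟧
    regroup x s y = begin-equality
      ⟦ f x S.* χ S x ⟧ * ⟦ s S.* χ S y ⟧      ≈⟨ ⟦⟧-homo-* (f x S.* χ S x) (s S.* χ S y) ⟨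
      ⟦ f x S.* χ S x S.* (s S.* χ S y) ⟧      ≡⟨ ≡.cong ⟦_⟧ (interchange (f x) (χ S x) s (χ S y)) ⟩
      ⟦ (f x S.* s) S.* (χ S x S.* χ S y) ⟧
        ≡⟨ ≡.cong (λ r → ⟦ (f x S.* s) S.* r ⟧) (χ-linear S x y) ⟩
      ⟦ (f x S.* s) S.* χ S (x ⊕ y) ⟧          ∎

  -- The expectation of f (⨁ xs) ∏ f (xᵢ), multiplied by 2 ^ (n k).
  bias : ∀ {n} → (Cube n → Sign) → ℕ → Carrier
  bias {n} f k = ∑[ xs ∈ tuples (cube n) k ] ⟦ f (⨁ xs) S.* ∏ (Vec.map f xs) ⟧

  -- Of the k + 1 factors only k are expanded over tuples. The remaining one is kept so that, after
  -- exchanging the sums, `inversion` at `⨁ xs` evaluates the sum over S.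
  ∑-F^k*F : ∀ {n} (f : Cube n → Sign) k →
            ∑[ S ∈ cube n ] (F f S ^ k * F f S) ≈ size (cube n) * bias f k
  ∑-F^k*F {n} f k = begin-equality
    ∑[ S ∈ cube n ] (F f S ^ k * F f S)
      ≈⟨ ∑-cong (cube n) (λ S → trans (*-congʳ (F-^ f S k)) (*-distribʳ-∑ Ω (F f S) _)) ⟩
    ∑[ S ∈ cube n ] ∑[ xs ∈ Ω ] (⟦ ∏ (Vec.map f xs) S.* χ S (⨁ xs) ⟧ * F f S)
      ≈⟨ ∑-comm (cube n) Ω _ ⟩
    ∑[ xs ∈ Ω ] ∑[ S ∈ cube n ] (⟦ ∏ (Vec.map f xs) S.* χ S (⨁ xs) ⟧ * F f S)
      ≈⟨ ∑-cong Ω (λ xs → invert (∏ (Vec.map f xs)) (⨁ xs)) ⟩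
    ∑[ xs ∈ Ω ] (size (cube n) * ⟦ f (⨁ xs) S.* ∏ (Vec.map f xs) ⟧)
      ≈⟨ *-distribˡ-∑ Ω _ _ ⟨
    size (cube n) * bias f k ∎
    where
    Ω = tuples (cube n) k
    invert : ∀ s y → ∑[ S ∈ cube n ] (⟦ s S.* χ S y ⟧ * F f S) ≈ size (cube n) * ⟦ f y S.* s ⟧
    invert s y = begin-equality
      ∑[ S ∈ cube n ] (⟦ s S.* χ S y ⟧ * F f S)
        ≈⟨ ∑-cong (cube n) (λ S → trans (*-congʳ (⟦⟧-homo-* s (χ S y))) (*-assoc _ _ _)) ⟩
      ∑[ S ∈ cube n ] (⟦ s ⟧ * (⟦ χ S y ⟧ * F f S))
        ≈⟨ *-distribˡ-∑ (cube n) _ _ ⟨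
      ⟦ s ⟧ * (∑[ S ∈ cube n ] (⟦ χ S y ⟧ * F f S))
        ≈⟨ *-congˡ (inversion n f y) ⟩
      ⟦ s ⟧ * (size (cube n) * ⟦ f y ⟧)
        ≈⟨ solve 3 (λ s c t → s :* (c :* t) := c :* (t :* s)) refl _ _ _ ⟩
      size (cube n) * (⟦ f y ⟧ * ⟦ s ⟧)
        ≈⟨ *-congˡ (⟦⟧-homo-* (f y) s) ⟨
      size (cube n) * ⟦ f y S.* s ⟧ ∎

  -- The case k = 1 of `∑-F^k*F`, where each term of the bias is the square of a sign.
  parseval : ∀ {n} (f : Cube n → Sign) →
             ∑[ S ∈ cube n ] (F f S * F f S) ≈ size (cube n) * size (cube n)
  parseval {n} f = begin-equality
    ∑[ S ∈ cube n ] (F f S * F f S)      ≈⟨ ∑-cong (cube n) (λ S → *-congʳ (*-identityʳ (F f S))) ⟨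
    ∑[ S ∈ cube n ] (F f S ^ 1 * F f S)  ≈⟨ ∑-F^k*F f 1 ⟩
    size (cube n) * bias f 1             ≈⟨ *-congˡ bias₁ ⟩
    size (cube n) * size (cube n)        ∎
    where
    ⟦fx*fx⟧≈1 : ∀ (xs : Vec (Cube n) 1) → ⟦ f (⨁ xs) S.* ∏ (Vec.map f xs) ⟧ ≈ 1#
    ⟦fx*fx⟧≈1 (x ∷ []) = trans
      (reflexive (≡.cong ⟦_⟧ (≡.cong₂ S._*_
        (≡.cong f (zipWith-identityʳ xor-identityʳ x)) (S.*-identityʳ (f x)))))
      (⟦s*s⟧≈1 (f x))
    bias₁ : bias f 1 ≈ size (cube n)
    bias₁ = begin-equality
      bias f 1                                ≈⟨ ∑-cong (tuples (cube n) 1) ⟦fx*fx⟧≈1 ⟩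
      ∑[ _ ∈ tuples (cube n) 1 ] 1#           ≈⟨ ∑-1 (tuples (cube n) 1) ⟩
      size (tuples (cube n) 1)                ≈⟨ size-tuples (cube n) 1 ⟩
      size (cube n) ^ 1                       ≈⟨ *-identityʳ _ ⟩
      size (cube n)                           ∎

-- The first inequality: the rejection probability.

module Soundness {c ℓ₁ ℓ₂ ℓ₃} (K : OrderedField c ℓ₁ ℓ₂ ℓ₃) where
  open OrderedField K hiding (zero)
  open Testing K
  open OrderedFieldProperties K
  open Sums K
  open Fourier K
  open ≤-Reasoning

  module _ {n} (f : Cube n → Sign) {A ε : Carrier}
           (0≤A : 0# ≤ A) (A+2ε≈1 : A + 2 · ε ≈ 1#) (far : FarFromLinear ε f) where

    private
      instance _ = cube-nonZero n
      N = size (cube n)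

    0<N : 0# < N
    0<N = 0<size (cube n)
      where
      0<size : ∀ (Ω : List (Cube n)) .{{_ : NonZero (length Ω)}} → 0# < size Ω
      0<size (_ ∷ Ω) = 0<suc (length Ω)

    -- Farness from `χ S` means D ≥ ε N disagreements, and the correlation is N - 2 D. Both sides
    -- are compared after adding 2 D, with N written as A N + 2 ε N.
    F≤A*N : ∀ S → F f S ≤ A * N
    F≤A*N S = +-cancelʳ-≤ (2 · D) (begin
      F f S + 2 · D                   ≈⟨ correlation+2·disagreement≈size (cube n) f (χ S) ⟩
      N                               ≈⟨ *-identityˡ N ⟨
      1# * N                          ≈⟨ *-congʳ A+2ε≈1 ⟨
      (A + 2 · ε) * N                 ≈⟨ distribʳ N A _ ⟩
      A * N + 2 · ε * N               ≈⟨ +-congˡ (×-assoc-* 2 ε N) ⟩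
      A * N + 2 · (ε * N)
        ≈⟨ +-congˡ (·-congˡ 2 (trans (*-comm ε N) (·1-* (length (cube n)) ε))) ⟩
      A * N + 2 · (length (cube n) · ε)
        ≤⟨ +-monoʳ-≤ _ (·-mono-≤ 2 (x≤y/n⇒n·x≤y _ (far (χ S) (χ-linear S)))) ⟩
      A * N + 2 · D                   ∎)
      where D = size (filter (λ x → ¬? (f x S.≟ χ S x)) (cube n))

    -- After multiplying by N, the bias is a sum of powers of F with exponent m + 2. Splitting off a
    -- square leaves the odd exponent m, bounded termwise with the squares as nonnegative weights;
    -- their sum is N² by `parseval`, and one N cancels.
    bias-≤ : ∀ j → bias f (suc (suc (j ℕ.* 2))) ≤
                   A ^ suc (j ℕ.* 2) * size (tuples (cube n) (suc (suc (j ℕ.* 2))))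
    bias-≤ j = *-cancelˡ-≤ 0<N (begin
      N * bias f (suc m)                               ≈⟨ ∑-F^k*F f (suc m) ⟨
      ∑[ S ∈ cube n ] (F f S * F f S ^ m * F f S)
        ≈⟨ ∑-cong (cube n) (λ S → xy∙z≈y∙xz (F f S) _ (F f S)) ⟩
      ∑[ S ∈ cube n ] (F f S ^ m * (F f S * F f S))
        ≤⟨ ∑-mono-≤ (cube n) (λ S →
           *-monoˡ-≤ (square-nonNeg (F f S)) (^-odd-mono-≤ j 0≤A*N (F≤A*N S))) ⟩
      ∑[ S ∈ cube n ] ((A * N) ^ m * (F f S * F f S))  ≈⟨ *-distribˡ-∑ (cube n) _ _ ⟨
      (A * N) ^ m * (∑[ S ∈ cube n ] (F f S * F f S))  ≈⟨ *-cong (^-distrib-* A N m) (parseval f) ⟩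
      A ^ m * N ^ m * (N * N)
        ≈⟨ solve 3 (λ a p n → a :* p :* (n :* n) := n :* (a :* (n :* p))) refl _ _ N ⟩
      N * (A ^ m * N ^ suc m)
        ≈⟨ *-congˡ (*-congˡ (size-tuples (cube n) (suc m))) ⟨
      N * (A ^ m * size (tuples (cube n) (suc m)))     ∎)
      where
      m = suc (j ℕ.* 2)
      open CommutativeSemigroupProperties *-commutativeSemigroup using (xy∙z≈y∙xz)
      0≤A*N : 0# ≤ A * N
      0≤A*N = *-nonNeg 0≤A (<⇒≤ 0<N)

    -- Rejected tuples are exactly the disagreements between `f ∘ ⨁` and `∏ ∘ Vec.map f`, so the
    -- bias plus 2 R is the number of tuples, and `bias-≤` bounds R from below. The denominators are
    -- cleared first.
    half-≤-Pr : ∀ j → (1# - A ^ suc (j ℕ.* 2)) / 2 ≤ Pr[XorTest suc (suc (j ℕ.* 2)) rejects f ]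
    half-≤-Pr j = n·x≤y⇒x≤y/n (length Ω) (·-cancel-≤ 2 (+-cancelˡ-≤ (A ^ m * size Ω) (begin
      A ^ m * size Ω + 2 · (length Ω · p)  ≈⟨ +-congˡ (·-comm 2 (length Ω) p) ⟩
      A ^ m * size Ω + length Ω · (2 · p)  ≈⟨ +-congˡ (·-congˡ (length Ω) (·-/ 2 _)) ⟩
      A ^ m * size Ω + length Ω · (1# - A ^ m)
        ≈⟨ +-cong (*-comm _ _) (sym (·1-* (length Ω) _)) ⟩
      size Ω * A ^ m + size Ω * (1# - A ^ m)
        ≈⟨ distribˡ (size Ω) _ _ ⟨
      size Ω * (A ^ m + (1# - A ^ m))      ≈⟨ *-congˡ (x+[y-x]≈y (A ^ m) 1#) ⟩
      size Ω * 1#                          ≈⟨ *-identityʳ _ ⟩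
      size Ω
        ≈⟨ correlation+2·disagreement≈size Ω (f ∘ ⨁) (∏ ∘ Vec.map f) ⟨
      bias f (suc m) + 2 · R               ≤⟨ +-mono-≤ (bias-≤ j) (≤-reflexive refl) ⟩
      A ^ m * size Ω + 2 · R               ∎)))
      where
      m = suc (j ℕ.* 2)
      Ω = tuples (cube n) (suc m)
      p = (1# - A ^ m) / 2
      R = size (filter (xorTestRejects? f) Ω)
      instance _ = tuples-nonZero (cube n) (suc m)

lemma3p1 : ∀ {c ℓ₁ ℓ₂ ℓ₃} (K : OrderedField c ℓ₁ ℓ₂ ℓ₃) →
    let open OrderedField K
        open Testing K
    in (n k : ℕ) (f : Cube n → Sign) (ε : Carrier) →
       0# < ε → ε ≤ 1# / 2 →
       FarFromLinear ε f →
       2 ≤ℕ k → 2 ∣ k →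
       (Pr[XorTest k rejects f ] ≥ (1# - (1# - 2 · ε) ^ (k ∸ 1)) / 2)
       × ((1# - (1# - 2 · ε) ^ (k ∸ 1)) / 2 ≥ (1# / 4) ⊓ ((k · ε) / 2))
lemma3p1 K n _ f ε 0<ε ε≤½ far () (divides zero ≡.refl)
-- Here k is `suc j * 2`, which computes to 2j + 2, so `k ∸ 1` is the odd number 2j + 1 and the
-- power bound is taken at m = 2j.
lemma3p1 K n _ f ε 0<ε ε≤½ far _  (divides (suc j) ≡.refl) =
  Soundness.half-≤-Pr K f 0≤A A+2ε≈1 far j ,
  PowerBound.⊓-≤-half K 0≤A 0<ε A+2ε≈1 (j ℕ.* 2)
  where
  open OrderedField K
  open OrderedFieldProperties K
  A+2ε≈1 : (1# - 2 · ε) + 2 · ε ≈ 1#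
  A+2ε≈1 = trans (+-comm _ _) (x+[y-x]≈y (2 · ε) 1#)
  0≤A : 0# ≤ 1# - 2 · ε
  0≤A = x≤y⇒0≤y-x (x≤y/n⇒n·x≤y 2 ε≤½)
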